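{- Let $\mathcal D=(\mathcal P,\mathcal B,\mathcal I)$ be a $2$-$(v,k,\lambda)$ design and let $G=\mathrm{Aut}(\mathcal D)$. Then $\mathcal D$ is trivial and $G$-pairwise transitive if and only if either (a) $k=2$ and $\lambda=1$; or (b) $k=v$ and $\lambda=|\mathcal B|$.
   Context: A design $\mathcal D=(\mathcal P,\mathcal B,\mathcal I)$ consists of finite sets $\mathcal P$ (points), $\mathcal B$ (blocks) and an incidence relation $\mathcal I\subseteq\mathcal P\times\mathcal B$. It is a $2$-$(v,k,\lambda)$ design if $|\mathcal P|=v$, each block is incident with exactly $k$ points ($k\ge2$), and each pair of distinct points is incident with exactly $\lambda$ common blocks. Distinct blocks may be incident with the same set of points. The design is non-trivial if $2<k<v$, and trivial otherwise. An automorphism is a permutation of $\mathcal P\cup\mathcal B$ leaving $\mathcal P$ and $\mathcal B$ invariant setwise and preserving incidence; $\mathrm{Aut}(\mathcal D)$ is the group of all automorphisms. Two blocks are intersecting if some point is incident with both. For $G\le\mathrm{Aut}(\mathcal D)$, the $2$-design $\mathcal D$ is $G$-pairwise transitive if $G$ is transitive on each of the following five (possibly empty) sets of ordered pairs: pairs of distinct points, incident point-block pairs, non-incident point-block pairs, pairs of distinct intersecting blocks, pairs of non-intersecting blocks.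
   Formalization: The design is assumed to have at least one block; without this the claim fails, e.g. for v=5, k=2, λ=0 and no blocks, which is trivial and pairwise transitive but satisfies neither (a) nor (b). -}

module Defs where

open import Data.Fin.Base using (Fin)
open import Data.Nat.Base using (ℕ; _≤_; _<_)
open import Data.Product.Base using (∃; ∃-syntax; _×_; proj₁)
open import Data.Sum.Base using (_⊎_; inj₁; inj₂)
open import Function.Bundles using (_↔_; _⇔_; Inverse)
open import Level using (0ℓ)
open import Relation.Binary.Core using (REL; Rel)
open import Relation.Binary.Definitions using (Decidable; Irrelevant)
open import Relation.Binary.PropositionalEquality.Core using (_≡_; _≢_)
open import Relation.Nullary.Negation.Core using (¬_)
open import Relation.Unary using (Pred)

HasSize : Set → ℕ → Set
HasSize A n = A ↔ Fin n

-- Incidence is a subset of Point × Block: decidability is the constructive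
-- rendering of a subset of a finite set, and irrelevance ensures that
-- ∃[ p ] p I B has one element per incident point.
-- Nothing forces blocks with the same points to be equal.
record Design : Set₁ where
  infix 4 _I_ _I?_
  field
    Point        : Set
    Block        : Set
    point-finite : ∃ (HasSize Point)
    block-finite : ∃ (HasSize Block)
    _I_          : REL Point Block 0ℓ
    _I?_         : Decidable _I_
    I-irrelevant : Irrelevant _I_

  #Point : ℕ
  #Point = proj₁ point-finite

  #Block : ℕ
  #Block = proj₁ block-finite

  Intersecting : Rel Block 0ℓ
  Intersecting B C = ∃[ p ] (p I B × p I C)

  Element : Set
  Element = Point ⊎ Block

  Perm : Set
  Perm = Element ↔ Element

record Is2Design (D : Design) (v k l : ℕ) : Set where
  open Design D
  field
    point-count : #Point ≡ v
    2≤k         : 2 ≤ k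
    block-size  : ∀ B → HasSize (∃[ p ] p I B) k
    pair-count  : ∀ {p q} → p ≢ q → HasSize (∃[ B ] (p I B × q I B)) l

NonTrivial : (v k : ℕ) → Set
NonTrivial v k = 2 < k × k < v

Trivial : (v k : ℕ) → Set
Trivial v k = ¬ NonTrivial v k

module _ (D : Design) where
  open Design D

  -- For a permutation of Point ⊎ Block, mapping each part into itself is the
  -- same as leaving each part invariant setwise.
  record IsAutomorphism (π : Perm) : Set where
    open Inverse π using (to)
    field
      point-invariant : ∀ p → ∃[ q ] to (inj₁ p) ≡ inj₁ q
      block-invariant : ∀ B → ∃[ C ] to (inj₂ B) ≡ inj₂ C
      incidence       : ∀ {p q B C} → to (inj₁ p) ≡ inj₁ q → to (inj₂ B) ≡ inj₂ C →
                        p I B ⇔ q I C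

  Aut : Pred Perm 0ℓ
  Aut = IsAutomorphism

  -- Transitivity of G on the set of ordered pairs (ι x , κ y) with R x y;
  -- vacuous when that set is empty.
  TransitiveOn : Pred Perm 0ℓ → {X Y : Set} → (X → Element) → (Y → Element) →
                 REL X Y 0ℓ → Set
  TransitiveOn G ι κ R = ∀ {x y x′ y′} → R x y → R x′ y′ →
    ∃[ π ] (G π × Inverse.to π (ι x) ≡ ι x′ × Inverse.to π (κ y) ≡ κ y′)

  -- Meant for G the underlying set of a subgroup of Aut, such as Aut itself; only
  -- membership in G matters.
  record PairwiseTransitive (G : Pred Perm 0ℓ) : Set where
    field
      distinct-points     : TransitiveOn G inj₁ inj₁ _≢_
      flags               : TransitiveOn G inj₁ inj₂ _I_
      antiflags           : TransitiveOn G inj₁ inj₂ (λ p B → ¬ (p I B))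
      intersecting-blocks : TransitiveOn G inj₂ inj₂ (λ B C → B ≢ C × Intersecting B C)
      disjoint-blocks     : TransitiveOn G inj₂ inj₂ (λ B C → ¬ Intersecting B C)

{-# OPTIONS --safe #-}

-- A trivial design has k = v, where every point lies on every block, or k = 2.
-- In the latter case with v > 2, λ ≥ 2 would give both pairs of blocks sharing
-- two points and pairs sharing exactly one, which no automorphism can exchange.
-- Conversely, if k = v then any permutations of points and of blocks together
-- form an automorphism; if k = 2 and λ = 1, blocks are the 2-subsets of the
-- points, so every permutation of the points acts. In both cases it remains to
-- extend injections between subsets of a finite set to permutations.
module Submission where

open import Defs
open import Data.Nat.Base using (ℕ; _<_)
open import Data.Product.Base using (_×_)
open import Data.Sum.Base using (_⊎_)
open import Function.Bundles using (_⇔_)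
open import Relation.Binary.PropositionalEquality.Core using (_≡_)

open import Data.Fin.Base using (Fin; zero; suc; fromℕ<; inject≤)
open import Data.Fin.Patterns using (0F; 1F)
open import Data.Fin.Permutation using (↔⇒≡)
open import Data.Fin.Properties using (injective⇒≤; inj⇒≟; inject≤-injective; nonZeroIndex; ¬∀⟶∃¬)
open import Data.List.Base using (List; []; _∷_)
open import Data.List.Relation.Unary.All as All using (All; []; _∷_)
open import Data.List.Relation.Unary.AllPairs using (AllPairs; []; _∷_)
open import Data.Nat.Base using (suc; _≤_; >-nonZero⁻¹)
open import Data.Nat.Properties using (≤-antisym; ≮⇒≥; <-irrefl; <⇒≱; _<?_)
open import Data.Product.Base using (∃-syntax; Σ-syntax; _,_; proj₁; proj₂)
open import Data.Sum.Base using (inj₁; inj₂; [_,_]′)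
open import Data.Sum.Function.Propositional using (_⊎-↔_)
open import Function.Base using (_∘_; _$_)
open import Function.Bundles
  using (_↔_; _↣_; mk↔ₛ′; mk⇔; mk↣; module Inverse; module Injection; module Equivalence)
open import Function.Definitions using (Injective)
open import Function.Properties.Inverse using (↔-refl; ↔-sym; ↔-trans; ↔⇒↣)
open import Relation.Binary.Definitions using (DecidableEquality)
open import Relation.Binary.PropositionalEquality
  using (_≢_; refl; sym; trans; cong; cong₂; subst; subst₂; ≢-sym)
open import Relation.Nullary.Decidable using (yes; no; decidable-stable)
open import Relation.Nullary.Negation using (¬_; contradiction)

open Inverse using (to; from; strictlyInverseʳ)

private
  variable
    A B : Set
    m n : ℕ

to-injective : (f : A ↔ B) → Injective _≡_ _≡_ (to f)
to-injective f = Injection.injective (↔⇒↣ f)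

size-≟ : HasSize A n → DecidableEquality A
size-≟ f = inj⇒≟ (↔⇒↣ f)

size-≤ : HasSize A m → HasSize B n → A ↣ B → m ≤ n
size-≤ f g i = injective⇒≤ (to-injective (↔-sym f) ∘ Injection.injective i ∘ to-injective g)

size-< : HasSize A m → HasSize B n → (i : A ↣ B) →
         ∃[ b ] (∀ a → Injection.to i a ≢ b) → m < n
size-< {A} {m} {B} f g i (b , missed) =
  injective⇒≤ (h-injective ∘ to-injective g)
  where
  h : Fin (suc m) → B
  h zero    = b
  h (suc j) = Injection.to i (from f j)

  h-injective : Injective _≡_ _≡_ h
  h-injective {zero}  {zero}  _  = refl
  h-injective {zero}  {suc _} eq = contradiction (sym eq) (missed _)
  h-injective {suc _} {zero}  eq = contradiction eq (missed _)
  h-injective {suc _} {suc _} eq =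
    cong suc (to-injective (↔-sym f) (Injection.injective i eq))

size-1 : HasSize A 1 → (x y : A) → x ≡ y
size-1 f x y = to-injective f (Fin1 (to f x) (to f y))
  where
  Fin1 : (i j : Fin 1) → i ≡ j
  Fin1 0F 0F = refl

size-2 : HasSize A 2 → {x y : A} → x ≢ y → ∀ z → z ≡ x ⊎ z ≡ y
size-2 f {x} {y} x≢y z
  with Fin2 (to f x) (to f y) (to f z) (x≢y ∘ to-injective f)
  where
  Fin2 : (i j l : Fin 2) → i ≢ j → l ≡ i ⊎ l ≡ j
  Fin2 0F 0F _  i≢j = contradiction refl i≢j
  Fin2 0F 1F 0F _   = inj₁ refl
  Fin2 0F 1F 1F _   = inj₂ refl
  Fin2 1F 0F 0F _   = inj₂ refl
  Fin2 1F 0F 1F _   = inj₁ refl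
  Fin2 1F 1F _  i≢j = contradiction refl i≢j
... | inj₁ eq = inj₁ (to-injective f eq)
... | inj₂ eq = inj₂ (to-injective f eq)

two-elements : HasSize A n → 2 ≤ n → ∃[ x ] ∃[ y ] _≢_ {A = A} x y
two-elements f 2≤n =
  from f (inject≤ 0F 2≤n) , from f (inject≤ 1F 2≤n) , λ eq →
    contradiction (inject≤-injective 2≤n 2≤n _ _ (to-injective (↔-sym f) eq)) λ ()

module _ (_≟_ : DecidableEquality A) where

  swap : A → A → A → A
  swap a b x with x ≟ a
  ... | yes _ = b
  ... | no  _ with x ≟ b
  ...   | yes _ = a
  ...   | no  _ = x

  swap-left : ∀ a b → swap a b a ≡ b
  swap-left a b with a ≟ a
  ... | yes _   = refl
  ... | no  a≢a = contradiction refl a≢a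

  swap-right : ∀ a b → swap a b b ≡ a
  swap-right a b with b ≟ a
  ... | yes b≡a = b≡a
  ... | no  _ with b ≟ b
  ...   | yes _   = refl
  ...   | no  b≢b = contradiction refl b≢b

  swap-fixes : ∀ {a b x} → x ≢ a → x ≢ b → swap a b x ≡ x
  swap-fixes {a} {b} {x} x≢a x≢b with x ≟ a
  ... | yes x≡a = contradiction x≡a x≢a
  ... | no  _ with x ≟ b
  ...   | yes x≡b = contradiction x≡b x≢b
  ...   | no  _   = refl

  swap-involutive : ∀ a b x → swap a b (swap a b x) ≡ x
  swap-involutive a b x with x ≟ a
  ... | yes refl = swap-right a b
  ... | no  x≢a with x ≟ b
  ...   | yes refl = swap-left a b
  ...   | no  x≢b  = swap-fixes x≢a x≢b

  transposition : A → A → A ↔ A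
  transposition a b = mk↔ₛ′ (swap a b) (swap a b) (swap-involutive a b) (swap-involutive a b)

  PartialInjection : List (A × A) → Set
  PartialInjection = AllPairs λ (x , x′) (y , y′) → x ≢ y × x′ ≢ y′

  abstract
    extend : ∀ ps → PartialInjection ps →
             Σ[ σ ∈ A ↔ A ] All (λ (x , x′) → to σ x ≡ x′) ps
    extend []             []                = ↔-refl , []
    extend ((a , b) ∷ ps) (fresh ∷ pairwise) with extend ps pairwise
    ... | σ , maps =
      ↔-trans σ (transposition (to σ a) b) ,
      swap-left (to σ a) b ∷ All.zipWith keeps (fresh , maps)
      where
      keeps : ∀ {p} → (a ≢ proj₁ p × b ≢ proj₂ p) × to σ (proj₁ p) ≡ proj₂ p →
              swap (to σ a) b (to σ (proj₁ p)) ≡ proj₂ p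
      keeps ((a≢x , b≢x′) , σx≡x′) = trans
        (swap-fixes (λ eq → a≢x (sym (to-injective σ eq))) (λ eq → b≢x′ (trans (sym eq) σx≡x′)))
        σx≡x′

  move₂ : ∀ {x y x′ y′} → x ≢ y → x′ ≢ y′ → Σ[ σ ∈ A ↔ A ] (to σ x ≡ x′ × to σ y ≡ y′)
  move₂ x≢y x′≢y′
    with extend ((_ , _) ∷ (_ , _) ∷ []) (((x≢y , x′≢y′) ∷ []) ∷ [] ∷ [])
  ... | σ , σx ∷ σy ∷ [] = σ , σx , σy

module _ (D : Design) where
  open Design D

  ⊎-automorphism : (σ : Point ↔ Point) (τ : Block ↔ Block) →
                   (∀ {p B} → p I B ⇔ to σ p I to τ B) → Aut D (σ ⊎-↔ τ)
  ⊎-automorphism σ τ preserves = record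
    { point-invariant = λ p → to σ p , refl
    ; block-invariant = λ B → to τ B , refl
    ; incidence       = λ { refl refl → preserves }
    }

  module _ {v k l : ℕ} (2-design : Is2Design D v k l) where
    open Is2Design 2-design

    points : HasSize Point v
    points = subst (HasSize Point) point-count (proj₂ point-finite)

    _≟ᵖ_ : DecidableEquality Point
    _≟ᵖ_ = size-≟ points

    _≟ᵇ_ : DecidableEquality Block
    _≟ᵇ_ = size-≟ (proj₂ block-finite)

    flag-≡ : ∀ {p q B} {pIB : p I B} {qIB : q I B} → p ≡ q →
             _≡_ {A = ∃[ r ] r I B} (p , pIB) (q , qIB)
    flag-≡ refl = cong (_ ,_) (I-irrelevant _ _)

    pair-≡ : ∀ {p q B C} {pqB : p I B × q I B} {pqC : p I C × q I C} → B ≡ C →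
             _≡_ {A = ∃[ E ] (p I E × q I E)} (B , pqB) (C , pqC)
    pair-≡ refl = cong (_ ,_) (cong₂ _,_ (I-irrelevant _ _) (I-irrelevant _ _))

    inclusion : ∀ B → (∃[ p ] p I B) ↣ Point
    inclusion B = mk↣ {to = proj₁} flag-≡

    k≤v : Block → k ≤ v
    k≤v B = size-≤ (block-size B) points (inclusion B)

    two-points : ∀ B → ∃[ p ] ∃[ q ] (p ≢ q × p I B × q I B)
    two-points B with two-elements (block-size B) 2≤k
    ... | (p , pIB) , (q , qIB) , ≢ = p , q , ≢ ∘ flag-≡ , pIB , qIB

    full : k ≡ v → ∀ p B → p I B
    full k≡v p B = decidable-stable (p I? B) λ ¬pIB →
      <-irrefl k≡v (size-< (block-size B) points (inclusion B)
        (p , λ (_ , qIB) q≡p → ¬pIB (subst (_I B) q≡p qIB)))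

    outside : k < v → ∀ B → ∃[ p ] ¬ (p I B)
    outside k<v B with ¬∀⟶∃¬ v _ (λ i → from points i I? B) not-all
      where
      not-all : ¬ (∀ i → from points i I B)
      not-all all = <⇒≱ k<v (size-≤ points (block-size B)
        (mk↣ {to = λ p → p , subst (_I B) (strictlyInverseʳ points p) (all (to points p))}
          (cong proj₁)))
    ... | i , ¬I = from points i , ¬I

    apart : ∀ {p q B} → p I B → ¬ (q I B) → p ≢ q
    apart pIB ¬qIB refl = ¬qIB pIB

    k≡v⇒l≡#Block : k ≡ v → Block → l ≡ #Block
    k≡v⇒l≡#Block k≡v B₀ with two-points B₀
    ... | p , q , p≢q , _ = ↔⇒≡ $
      ↔-trans (↔-sym (pair-count p≢q))
        (↔-trans
          (mk↔ₛ′ proj₁ (λ B → B , full k≡v p B , full k≡v q B) (λ _ → refl) (λ _ → pair-≡ refl))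
          (proj₂ block-finite))

    k≡v⇒pairwise-transitive : k ≡ v → PairwiseTransitive D (Aut D)
    k≡v⇒pairwise-transitive k≡v = record
      { distinct-points = λ {p} {q} {p′} {q′} p≢q p′≢q′ →
          let σ , σp , σq = move₂ _≟ᵖ_ p≢q p′≢q′
          in  _ , any-automorphism σ ↔-refl , cong inj₁ σp , cong inj₁ σq
      ; flags = λ {p} {B} {p′} {B′} _ _ →
          _ , any-automorphism (transposition _≟ᵖ_ p p′) (transposition _≟ᵇ_ B B′) ,
          cong inj₁ (swap-left _≟ᵖ_ p p′) , cong inj₂ (swap-left _≟ᵇ_ B B′)
      ; antiflags = λ ¬pIB _ → contradiction (full k≡v _ _) ¬pIB
      ; intersecting-blocks = λ (B≢C , _) (B′≢C′ , _) →
          let τ , τB , τC = move₂ _≟ᵇ_ B≢C B′≢C′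
          in  _ , any-automorphism ↔-refl τ , cong inj₂ τB , cong inj₂ τC
      ; disjoint-blocks = λ {B} ¬meet _ →
          let p , _ = two-points B
          in  contradiction (p , full k≡v _ _ , full k≡v _ _) ¬meet
      }
      where
      any-automorphism : ∀ σ τ → Aut D (σ ⊎-↔ τ)
      any-automorphism σ τ =
        ⊎-automorphism σ τ (mk⇔ (λ _ → full k≡v _ _) (λ _ → full k≡v _ _))

    module _ (k≡2 : k ≡ 2) where

      block-pair : ∀ {p q r B} → p ≢ q → p I B → q I B → r I B → r ≡ p ⊎ r ≡ q
      block-pair {B = B} p≢q pIB qIB rIB =
        [ inj₁ ∘ cong proj₁ , inj₂ ∘ cong proj₁ ]′
        (size-2 (subst (HasSize _) k≡2 (block-size B)) {_ , pIB} {_ , qIB} (p≢q ∘ cong proj₁) (_ , rIB))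

      intersecting⇒l≡1 : Block → k < v → PairwiseTransitive D (Aut D) → l ≡ 1
      intersecting⇒l≡1 B₀ k<v transitive with two-points B₀
      ... | p , q , p≢q , pIB₀ , qIB₀ = ≤-antisym (≮⇒≥ 1≮l) 1≤l
        where
        1≤l : 1 ≤ l
        1≤l = >-nonZero⁻¹ l {{nonZeroIndex (to (pair-count p≢q) (B₀ , pIB₀ , qIB₀))}}

        -- If B and B′ share p and q while C contains p and some r outside B, then
        -- no automorphism takes (B , C) to (B , B′): the image of r would be a
        -- third point of B′.
        1≮l : ¬ (1 < l)
        1≮l 1<l with two-elements (pair-count p≢q) 1<l
        ... | (B , pIB , qIB) , (B′ , pIB′ , qIB′) , ≢ with outside k<v B
        ...   | r , ¬rIB with from (pair-count (apart pIB ¬rIB)) (inject≤ 0F 1≤l)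
        ...     | C , pIC , rIC
          with PairwiseTransitive.intersecting-blocks transitive
                 ((λ { refl → ¬rIB rIC }) , p , pIB , pIC)
                 (≢ ∘ pair-≡ , p , pIB , pIB′)
        ...       | π , automorphism , πB , πC
          with IsAutomorphism.point-invariant automorphism r
        ...         | r′ , πr = ¬rIB (Equivalence.from (incidence πr πB) r′IB)
          where
          open IsAutomorphism automorphism using (incidence)

          r′IB : r′ I B
          r′IB with block-pair p≢q pIB′ qIB′ (Equivalence.to (incidence πr πC) rIC)
          ... | inj₁ refl = pIB
          ... | inj₂ refl = qIB

      module _ (l≡1 : l ≡ 1) where

        join : ∀ {p q} → p ≢ q → ∃[ B ] (p I B × q I B)
        join p≢q = from (pair-count p≢q) (subst Fin (sym l≡1) 0F)

        joined-once : ∀ {p q B C} → p ≢ q → p I B → q I B → p I C → q I C → B ≡ C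
        joined-once p≢q pIB qIB pIC qIC = cong proj₁ $
          size-1 (subst (HasSize _) l≡1 (pair-count p≢q)) (_ , pIB , qIB) (_ , pIC , qIC)

        other : ∀ {p B} → p I B → ∃[ q ] (p ≢ q × q I B)
        other {p} {B} pIB with two-points B
        ... | q , r , q≢r , qIB , rIB with block-pair q≢r qIB rIB pIB
        ...   | inj₁ refl = r , q≢r , rIB
        ...   | inj₂ refl = q , ≢-sym q≢r , qIB

        has-image : ∀ (σ : Point ↔ Point) B → ∃[ C ] (∀ {p} → p I B → to σ p I C)
        has-image σ B with two-points B
        ... | q , r , q≢r , qIB , rIB with join (q≢r ∘ to-injective σ)
        ...   | C , σqIC , σrIC =
          C , λ pIB → [ (λ { refl → σqIC }) , (λ { refl → σrIC }) ]′ (block-pair q≢r qIB rIB pIB)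

        image : Point ↔ Point → Block → Block
        image σ B = proj₁ (has-image σ B)

        image-I : ∀ σ {p B} → p I B → to σ p I image σ B
        image-I σ {B = B} = proj₂ (has-image σ B)

        image-≡ : ∀ σ {p q p′ q′ B B′} → p ≢ q → p I B → q I B → p′ I B′ → q′ I B′ →
                  to σ p ≡ p′ → to σ q ≡ q′ → image σ B ≡ B′
        image-≡ σ p≢q pIB qIB p′IB′ q′IB′ refl refl =
          joined-once (p≢q ∘ to-injective σ) (image-I σ pIB) (image-I σ qIB) p′IB′ q′IB′

        image-inverse : ∀ (σ : Point ↔ Point) B → image (↔-sym σ) (image σ B) ≡ B
        image-inverse σ B =
          let p , q , p≢q , pIB , qIB = two-points B
          in  image-≡ (↔-sym σ) (p≢q ∘ to-injective σ) (image-I σ pIB) (image-I σ qIB) pIB qIB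
                (strictlyInverseʳ σ p) (strictlyInverseʳ σ q)

        on-blocks : Point ↔ Point → Block ↔ Block
        on-blocks σ = mk↔ₛ′ (image σ) (image (↔-sym σ)) (image-inverse (↔-sym σ)) (image-inverse σ)

        induced : Point ↔ Point → Perm
        induced σ = σ ⊎-↔ on-blocks σ

        induced-automorphism : ∀ σ → Aut D (induced σ)
        induced-automorphism σ = ⊎-automorphism σ (on-blocks σ) $ mk⇔ (image-I σ) λ σpI →
          subst₂ _I_ (strictlyInverseʳ σ _) (image-inverse σ _) (image-I (↔-sym σ) σpI)

        k≡2∧l≡1⇒pairwise-transitive : PairwiseTransitive D (Aut D)
        k≡2∧l≡1⇒pairwise-transitive = record
          { distinct-points = λ p≢q p′≢q′ →
              let σ , σp , σq = move₂ _≟ᵖ_ p≢q p′≢q′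
              in  induced σ , induced-automorphism σ , cong inj₁ σp , cong inj₁ σq
          ; flags = flags
          ; antiflags = antiflags
          ; intersecting-blocks = intersecting
          ; disjoint-blocks = disjoint
          }
          where
          flags : TransitiveOn D (Aut D) inj₁ inj₂ _I_
          flags pIB p′IB′ with other pIB | other p′IB′
          ... | q , p≢q , qIB | q′ , p′≢q′ , q′IB′ with move₂ _≟ᵖ_ p≢q p′≢q′
          ...   | σ , σp , σq =
            induced σ , induced-automorphism σ ,
            cong inj₁ σp , cong inj₂ (image-≡ σ p≢q pIB qIB p′IB′ q′IB′ σp σq)

          antiflags : TransitiveOn D (Aut D) inj₁ inj₂ (λ p B → ¬ (p I B))
          antiflags {p} {B} {p′} {B′} ¬pIB ¬p′IB′ with two-points B | two-points B′
          ... | q , r , q≢r , qIB , rIB | q′ , r′ , q′≢r′ , q′IB′ , r′IB′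
            with extend _≟ᵖ_ ((q , q′) ∷ (r , r′) ∷ (p , p′) ∷ [])
                   ( ((q≢r , q′≢r′) ∷ (apart qIB ¬pIB , apart q′IB′ ¬p′IB′) ∷ [])
                   ∷ ((apart rIB ¬pIB , apart r′IB′ ¬p′IB′) ∷ [])
                   ∷ [] ∷ [])
          ...   | σ , σq ∷ σr ∷ σp ∷ [] =
            induced σ , induced-automorphism σ ,
            cong inj₁ σp , cong inj₂ (image-≡ σ q≢r qIB rIB q′IB′ r′IB′ σq σr)

          intersecting : TransitiveOn D (Aut D) inj₂ inj₂ (λ B C → B ≢ C × Intersecting B C)
          intersecting (B≢C , p , pIB , pIC) (B′≢C′ , p′ , p′IB′ , p′IC′)
            with other pIB | other pIC | other p′IB′ | other p′IC′
          ... | q , p≢q , qIB | r , p≢r , rIC | q′ , p′≢q′ , q′IB′ | r′ , p′≢r′ , r′IC′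
            with extend _≟ᵖ_ ((p , p′) ∷ (q , q′) ∷ (r , r′) ∷ [])
                   ( ((p≢q , p′≢q′) ∷ (p≢r , p′≢r′) ∷ [])
                   ∷ (((λ { refl → B≢C (joined-once p≢q pIB qIB pIC rIC) })
                      , (λ { refl → B′≢C′ (joined-once p′≢q′ p′IB′ q′IB′ p′IC′ r′IC′) })) ∷ [])
                   ∷ [] ∷ [])
          ...   | σ , σp ∷ σq ∷ σr ∷ [] =
            induced σ , induced-automorphism σ ,
            cong inj₂ (image-≡ σ p≢q pIB qIB p′IB′ q′IB′ σp σq) ,
            cong inj₂ (image-≡ σ p≢r pIC rIC p′IC′ r′IC′ σp σr)

          disjoint : TransitiveOn D (Aut D) inj₂ inj₂ (λ B C → ¬ Intersecting B C)
          disjoint {B} {C} {B′} {C′} ¬BC ¬B′C′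
            with two-points B | two-points C | two-points B′ | two-points C′
          ... | p , q , p≢q , pIB , qIB | r , s , r≢s , rIC , sIC
              | p′ , q′ , p′≢q′ , p′IB′ , q′IB′ | r′ , s′ , r′≢s′ , r′IC′ , s′IC′
            with extend _≟ᵖ_ ((p , p′) ∷ (q , q′) ∷ (r , r′) ∷ (s , s′) ∷ [])
                   ( ((p≢q , p′≢q′) ∷ across pIB rIC p′IB′ r′IC′ ∷ across pIB sIC p′IB′ s′IC′ ∷ [])
                   ∷ (across qIB rIC q′IB′ r′IC′ ∷ across qIB sIC q′IB′ s′IC′ ∷ [])
                   ∷ ((r≢s , r′≢s′) ∷ [])
                   ∷ [] ∷ [])
            where
            across : ∀ {x y x′ y′} → x I B → y I C → x′ I B′ → y′ I C′ → x ≢ y × x′ ≢ y′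
            across xIB yIC x′IB′ y′IC′ =
              (λ { refl → ¬BC (_ , xIB , yIC) }) , (λ { refl → ¬B′C′ (_ , x′IB′ , y′IC′) })
          ...   | σ , σp ∷ σq ∷ σr ∷ σs ∷ [] =
            induced σ , induced-automorphism σ ,
            cong inj₂ (image-≡ σ p≢q pIB qIB p′IB′ q′IB′ σp σq) ,
            cong inj₂ (image-≡ σ r≢s rIC sIC r′IC′ s′IC′ σr σs)

lemma2p1 : (D : Design) (v k l : ℕ) → Is2Design D v k l → 0 < Design.#Block D →
    (Trivial v k × PairwiseTransitive D (Aut D))
    ⇔ ((k ≡ 2 × l ≡ 1) ⊎ (k ≡ v × l ≡ Design.#Block D))
lemma2p1 D v k l 2-design 0<#Block = mk⇔ classify realise
  where
  open Is2Design 2-design using (2≤k)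

  B₀ : Design.Block D
  B₀ = from (proj₂ (Design.block-finite D)) (fromℕ< 0<#Block)

  classify : Trivial v k × PairwiseTransitive D (Aut D) →
             (k ≡ 2 × l ≡ 1) ⊎ (k ≡ v × l ≡ Design.#Block D)
  classify (trivial , transitive) with k <? v
  ... | yes k<v = inj₁ (k≡2 , intersecting⇒l≡1 D 2-design k≡2 B₀ k<v transitive)
    where
    k≡2 : k ≡ 2
    k≡2 = ≤-antisym (≮⇒≥ λ 2<k → trivial (2<k , k<v)) 2≤k
  ... | no k≮v = inj₂ (k≡v , k≡v⇒l≡#Block D 2-design k≡v B₀)
    where
    k≡v : k ≡ v
    k≡v = ≤-antisym (k≤v D 2-design B₀) (≮⇒≥ k≮v)

  realise : (k ≡ 2 × l ≡ 1) ⊎ (k ≡ v × l ≡ Design.#Block D) →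
            Trivial v k × PairwiseTransitive D (Aut D)
  realise (inj₁ (k≡2 , l≡1)) =
    (λ (2<k , _) → <-irrefl (sym k≡2) 2<k) , k≡2∧l≡1⇒pairwise-transitive D 2-design k≡2 l≡1
  realise (inj₂ (k≡v , _)) =
    (λ (_ , k<v) → <-irrefl k≡v k<v) , k≡v⇒pairwise-transitive D 2-design k≡v
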